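{- Let $t,n\in\mathbb{N}$ with $t\ge 3$ and $n\ge 3$. Then $$gr^t_2(B_n)\ge \begin{cases} \frac{4n+6}{3} & \text{if } n\equiv 0\pmod{3}, \\ \frac{5n+1}{3} & \text{if } n\equiv 1\pmod{3}, \\ \frac{4n+7}{3} & \text{if } n\equiv 2\pmod{3}.\end{cases}$$
   Context: $K_n$ is the complete graph of order $n$. The book $B_n:=K_2+nK_1$ (graph join) is the graph on $n+2$ vertices consisting of an edge $xy$ (the spine) together with $n$ further, pairwise non-adjacent vertices (the pages), each adjacent to both $x$ and $y$. A $t$-coloring of $K_p$ is a map $f:E(K_p)\to\{1,\dots,t\}$, not assumed surjective. A Gallai $t$-coloring is a $t$-coloring with no rainbow triangle, i.e. there are no three vertices $x,y,z$ such that $f(xy),f(xz),f(yz)$ are pairwise distinct. For $1\le s<t$ and a graph $G$, the weakened Gallai-Ramsey number $gr^t_s(G)$ is the least $p\in\mathbb{N}$ such that every Gallai $t$-coloring of $K_p$ contains a (not necessarily induced) subgraph isomorphic to $G$ whose edges use at most $s$ colors. -}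

module Defs where

open import Data.Empty using (⊥)
open import Data.Fin using (Fin)
open import Data.Fin.Subset using (Subset; ∣_∣) renaming (_∈_ to _∈ₛ_)
open import Data.Nat using (ℕ; _≤_)
open import Data.Product using (Σ-syntax; ∃-syntax; _×_)
open import Data.Sum using (_⊎_; inj₁; inj₂)
open import Function.Definitions using (Injective)
open import Relation.Binary.PropositionalEquality using (_≡_; _≢_; refl; ≢-sym)
open import Relation.Nullary using (¬_)

record Graph : Set₁ where
  field
    Vertex : Set
    Adj    : Vertex → Vertex → Set
    sym    : ∀ {x y} → Adj x y → Adj y x
    irrefl : ∀ {x} → ¬ Adj x x

open Graph public using (Vertex; Adj)

K : ℕ → Graph
K p = record
  { Vertex = Fin p
  ; Adj    = _≢_
  ; sym    = ≢-sym
  ; irrefl = λ x≢x → x≢x refl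
  }

-- The disjoint union nK₁ of n single vertices.
edgeless : ℕ → Graph
edgeless n = record
  { Vertex = Fin n
  ; Adj    = λ _ _ → ⊥
  ; sym    = λ ()
  ; irrefl = λ ()
  }

module _ (G H : Graph) where

  data JoinAdj : Vertex G ⊎ Vertex H → Vertex G ⊎ Vertex H → Set where
    left   : ∀ {x y} → Adj G x y → JoinAdj (inj₁ x) (inj₁ y)
    right  : ∀ {x y} → Adj H x y → JoinAdj (inj₂ x) (inj₂ y)
    cross  : ∀ {x y} → JoinAdj (inj₁ x) (inj₂ y)
    cross′ : ∀ {x y} → JoinAdj (inj₂ x) (inj₁ y)

  join : Graph
  join = record
    { Vertex = Vertex G ⊎ Vertex H
    ; Adj    = JoinAdj
    ; sym    = λ where
        (left e)  → left (Graph.sym G e)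
        (right e) → right (Graph.sym H e)
        cross     → cross′
        cross′    → cross
    ; irrefl = λ where
        (left e)  → Graph.irrefl G e
        (right e) → Graph.irrefl H e
    }

Book : ℕ → Graph
Book n = join (K 2) (edgeless n)

-- Edges are unordered pairs.  The law `colour-sym` quantifies over both
-- adjacency proofs, so (applied twice) it also makes the colour of an edge
-- independent of the proof that its endpoints are adjacent.
record Colouring (t : ℕ) (G : Graph) : Set where
  field
    colour     : ∀ {x y} → Adj G x y → Fin t
    colour-sym : ∀ {x y} (e : Adj G x y) (e′ : Adj G y x) → colour e ≡ colour e′

open Colouring public

RainbowTriangle : ∀ {t G} → Colouring t G → Set
RainbowTriangle {G = G} f =
  ∃[ x ] ∃[ y ] ∃[ z ]
  Σ[ xy ∈ Adj G x y ] Σ[ xz ∈ Adj G x z ] Σ[ yz ∈ Adj G y z ]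
    colour f xy ≢ colour f xz × colour f xy ≢ colour f yz × colour f xz ≢ colour f yz

IsGallai : ∀ {t G} → Colouring t G → Set
IsGallai f = ¬ RainbowTriangle f

-- A not necessarily induced subgraph of H isomorphic to G, given by an
-- isomorphism from G onto it.
record Copy (G H : Graph) : Set where
  field
    vertex    : Vertex G → Vertex H
    injective : Injective _≡_ _≡_ vertex
    edge      : ∀ {x y} → Adj G x y → Adj H (vertex x) (vertex y)

UsesAtMost : ∀ {t G H} → ℕ → Colouring t H → Copy G H → Set
UsesAtMost {t} {G} s f C =
  Σ[ S ∈ Subset t ] ∣ S ∣ ≤ s ×
    (∀ {x y} (e : Adj G x y) → colour f (Copy.edge C e) ∈ₛ S)

Forces : (t s : ℕ) → Graph → ℕ → Set
Forces t s G p =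
  (f : Colouring t (K p)) → IsGallai f → Σ[ C ∈ Copy G (K p) ] UsesAtMost s f C

-- `IsGallaiRamsey t s G p` says that p is the number gr^t_s(G).  It is a
-- relation because computing the least p would first require a proof of
-- Ramsey's theorem; by its minimality clause p is unique.
record IsGallaiRamsey (t s : ℕ) (G : Graph) (p : ℕ) : Set where
  field
    forces : Forces t s G p
    least  : ∀ q → Forces t s G q → p ≤ q

{-# OPTIONS --safe #-}

-- Blow up a 2-coloured complete graph on r points, replacing every point by s
-- vertices, with a third colour inside the blocks and possibly one apex joined
-- to everything in that third colour.  Such a colouring is always Gallai.  A
-- copy of Bₙ in at most two colours misses some colour d.  If d is the third
-- colour, the spine lies in two different blocks and the pages avoid both of
-- them and the apex, so n ≤ (r − 2) s.  Otherwise all n + 2 vertices of the book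
-- avoid the d-coloured neighbours of a spine end, so n + 2 ≤ 3 s + u as soon as
-- at most three blocks remain, where u ≤ 1 counts apices.  The bounds come from
--   n = 3k + 1 : the 5-cycle and its complement, s = k, with apex;
--   n = 3k     : the path P₄ and its complement, s = k, with apex;
--   n = 3k + 2 : the path P₄ and its complement, s = k + 1, without apex.
module Submission where

open import Data.Empty using (⊥)
open import Data.Fin using (Fin; zero; suc; toℕ; _≟_; inject≤; combine)
open import Data.Fin.Properties
  using (all?; any?; toℕ-injective; inject≤-injective; injective⇒≤; +↔⊎; *↔×;
         suc-injective; combine-injective)
open import Data.Fin.Subset using (Subset) renaming (∣_∣ to size; _∈_ to _∈ₛ_; _-_ to _∖_)
open import Data.Fin.Subset.Properties
  using (_∈?_; x∈p⇒∣p-x∣<∣p∣; x∈p∧x≢y⇒x∈p-y)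
open import Data.List using (List; length; filter; allFin)
open import Data.List.Membership.Propositional using (_∈_)
open import Data.List.Membership.Propositional.Properties using (∈-filter⁺; ∈-allFin)
import Data.List.Membership.Setoid.Properties as Membership
open import Data.List.Relation.Unary.Any using (index)
open import Data.Nat
  using (ℕ; zero; suc; _+_; _*_; _∸_; ∣_-_∣; _≤_; _<_; _≥_; _≤?_; z≤n; s≤s)
open import Data.Nat.DivMod using (_/_; _%_; m≡m%n+[m/n]*n; m*n/n≡m)
open import Data.Nat.Properties
  using (≤-trans; ≤-refl; <⇒≱; ≰⇒>; +-monoˡ-≤; *-monoˡ-≤; +-identityʳ; m≤m+n;
         ∣-∣-comm; ∣n-n∣≡0; ∣m-n∣≡0⇒m≡n; module ≤-Reasoning)
open import Data.Nat.Tactic.RingSolver using (solve-∀)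
open import Data.Product using (_×_; _,_; ∃-syntax; proj₁; proj₂)
open import Data.Sum using (_⊎_; inj₁; inj₂; map₁)
open import Data.Sum.Properties using (inj₁-injective; inj₂-injective)
open import Data.Unit using (⊤; tt)
open import Function using (_∘_; Injection; Inverse)
open import Function.Definitions using (Injective)
open import Function.Properties.Inverse using (↔⇒↣; ↔-sym)
open import Relation.Binary.PropositionalEquality
  using (_≡_; _≢_; refl; sym; trans; cong; subst; setoid)
open import Relation.Nullary using (¬_; yes; no; contradiction; ¬?; _×-dec_; _→-dec_)
open import Relation.Nullary.Decidable using (from-yes; decidable-stable)
open import Relation.Unary using (Decidable)
open import Defs

-- Counting inside a set of colours

image⊆⇒≤size : ∀ {m t} {g : Fin m → Fin t} (S : Subset t) →
  Injective _≡_ _≡_ g → (∀ i → g i ∈ₛ S) → m ≤ size S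
image⊆⇒≤size {zero}  S g-inj g∈S = z≤n
image⊆⇒≤size {suc m} {g = g} S g-inj g∈S =
  ≤-trans (s≤s (image⊆⇒≤size (S ∖ g zero) (suc-injective ∘ g-inj) rest))
          (x∈p⇒∣p-x∣<∣p∣ (g∈S zero))
  where
  rest : ∀ i → g (suc i) ∈ₛ S ∖ g zero
  rest i = x∈p∧x≢y⇒x∈p-y (g∈S (suc i)) λ eq → contradiction (g-inj eq) λ ()

-- Supplies the missing colour: three distinct colours cannot all lie in a set of at most two.
∃-outside : ∀ {m t} {g : Fin m → Fin t} (S : Subset t) →
  Injective _≡_ _≡_ g → size S < m → ∃[ i ] ¬ g i ∈ₛ S
∃-outside {g = g} S g-inj ∣S∣<m with any? (λ i → ¬? (g i ∈? S))
... | yes found = found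
... | no none   = contradiction (image⊆⇒≤size S g-inj covered) (<⇒≱ ∣S∣<m)
  where
  covered : ∀ i → g i ∈ₛ S
  covered i = decidable-stable (g i ∈? S) (λ gi∉S → none (i , gi∉S))

-- The shaded graphs P₄ and C₅

zero-among-distinct : ∀ {i j k : Fin 3} → i ≢ j → i ≢ k → j ≢ k →
  i ≡ zero ⊎ j ≡ zero ⊎ k ≡ zero
zero-among-distinct {zero}                           _ _ _ = inj₁ refl
zero-among-distinct {suc _} {zero}                   _ _ _ = inj₂ (inj₁ refl)
zero-among-distinct {suc _} {suc _} {zero}           _ _ _ = inj₂ (inj₂ refl)
zero-among-distinct {suc zero}       {suc zero}       {suc _} p _ _ = contradiction refl p
zero-among-distinct {suc (suc zero)} {suc (suc zero)} {suc _} p _ _ = contradiction refl p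
zero-among-distinct {suc zero}       {suc (suc zero)} {suc zero}       _ q _ = contradiction refl q
zero-among-distinct {suc zero}       {suc (suc zero)} {suc (suc zero)} _ _ q = contradiction refl q
zero-among-distinct {suc (suc zero)} {suc zero}       {suc zero}       _ _ q = contradiction refl q
zero-among-distinct {suc (suc zero)} {suc zero}       {suc (suc zero)} _ q _ = contradiction refl q

-- 1 on the edges of the path 0 1 … (r − 1), which the pair {0, 4} closes to a
-- 5-cycle when r = 5.
shade : ℕ → Fin 3
shade 0 = zero
shade 1 = suc zero
shade 4 = suc zero
shade _ = suc (suc zero)

shade-zero : ∀ m → shade m ≡ zero → m ≡ 0
shade-zero 0 _ = refl
shade-zero 1 ()
shade-zero 2 ()
shade-zero 3 ()
shade-zero 4 ()
shade-zero (suc (suc (suc (suc (suc _))))) ()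

-- The diagonal value `zero` is the colour inside a block, so `hue` alone colours all pairs of
-- vertices lying in blocks.
hue : ∀ {r} → Fin r → Fin r → Fin 3
hue a b = shade ∣ toℕ a - toℕ b ∣

hue-sym : ∀ {r} (a b : Fin r) → hue a b ≡ hue b a
hue-sym a b = cong shade (∣-∣-comm (toℕ a) (toℕ b))

hue-refl : ∀ {r} (a : Fin r) → hue a a ≡ zero
hue-refl a = cong shade (∣n-n∣≡0 (toℕ a))

hue-zero : ∀ {r} {a b : Fin r} → hue a b ≡ zero → a ≡ b
hue-zero {a = a} {b} eq = toℕ-injective (∣m-n∣≡0⇒m≡n (shade-zero _ eq))

module _ {r : ℕ} (d : Fin 3) (a b : Fin r) where

  avoids? : Decidable (λ c → hue a c ≢ d × hue b c ≢ d)
  avoids? c = ¬? (hue a c ≟ d) ×-dec ¬? (hue b c ≟ d)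

  -- For `d = zero` this drops exactly `a` and `b`; taking `b = a` gives the condition at a single
  -- point.
  avoiding : List (Fin r)
  avoiding = filter avoids? (allFin r)

  ∈-avoiding : ∀ {c} → hue a c ≢ d → hue b c ≢ d → c ∈ avoiding
  ∈-avoiding ac bc = ∈-filter⁺ avoids? (∈-allFin _) (ac , bc)

record Balanced (r : ℕ) : Set where
  field
    outside-pair  : ∀ (a b : Fin r) → a ≢ b → length (avoiding zero a b) ≤ r ∸ 2
    outside-shade : ∀ (a : Fin r) (d : Fin 2) → length (avoiding (suc d) a a) ≤ 3

-- Each point of P₄ meets an edge of either shade, so dropping one shade leaves at most three
-- points, the point itself included.
balanced-path : Balanced 4
balanced-path = record
  { outside-pair  = from-yes (all? λ a → all? λ b →
      ¬? (a ≟ b) →-dec length (avoiding {4} zero a b) ≤? 2)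
  ; outside-shade = from-yes (all? λ a → all? λ d →
      length (avoiding {4} (suc d) a a) ≤? 3)
  }

-- Each point of C₅ has two neighbours in either shade, so three of the five points remain.
balanced-cycle : Balanced 5
balanced-cycle = record
  { outside-pair  = from-yes (all? λ a → all? λ b →
      ¬? (a ≟ b) →-dec length (avoiding {5} zero a b) ≤? 3)
  ; outside-shade = from-yes (all? λ a → all? λ d →
      length (avoiding {5} (suc d) a a) ≤? 3)
  }

-- The blow-up and its Gallai property

BlowUp : ℕ → ℕ → ℕ → Set
BlowUp r s u = (Fin r × Fin s) ⊎ Fin u

module _ {r s u : ℕ} where

  tint : BlowUp r s u → BlowUp r s u → Fin 3
  tint (inj₁ (a , _)) (inj₁ (b , _)) = hue a b
  tint (inj₁ _)       (inj₂ _)       = zero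
  tint (inj₂ _)       _              = zero

  tint-sym : ∀ v w → tint v w ≡ tint w v
  tint-sym (inj₁ (a , _)) (inj₁ (b , _)) = hue-sym a b
  tint-sym (inj₁ _)       (inj₂ _)       = refl
  tint-sym (inj₂ _)       (inj₁ _)       = refl
  tint-sym (inj₂ _)       (inj₂ _)       = refl

  tint-refl : ∀ v → tint v v ≡ zero
  tint-refl (inj₁ (a , _)) = hue-refl a
  tint-refl (inj₂ _)       = refl

  -- Two edges at an apex share the colour `zero`. Without an apex, three distinct tints would
  -- include `zero`; then two corners share a block and see the third corner in the same hue.
  tint-gallai : ∀ x y z →
    tint x y ≢ tint x z → tint x y ≢ tint y z → tint x z ≢ tint y z → ⊥
  tint-gallai (inj₂ _) _ _ p _ _ = p refl
  tint-gallai (inj₁ _) (inj₂ _) _ _ q _ = q refl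
  tint-gallai (inj₁ _) (inj₁ _) (inj₂ _) _ _ q = q refl
  tint-gallai (inj₁ (a , _)) (inj₁ (b , _)) (inj₁ (c , _)) p q q′
    with zero-among-distinct p q q′
  ... | inj₁ ab        = q′ (cong (λ e → hue e c) (hue-zero {a = a} ab))
  ... | inj₂ (inj₁ ac) = q (trans (hue-sym a b) (cong (hue b) (hue-zero {a = a} ac)))
  ... | inj₂ (inj₂ bc) = p (cong (hue a) (hue-zero {a = b} bc))

  -- Counting vertices over a list of blocks

  Within : List (Fin r) → BlowUp r s u → Set
  Within L (inj₁ (a , _)) = a ∈ L
  Within L (inj₂ _)       = ⊤

  -- Addresses a vertex by the position of its block in `L` and its place in that block, which turns
  -- a bound on blocks into a bound on vertices.
  slot : ∀ {L} v → Within L v → Fin (length L * s) ⊎ Fin u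
  slot (inj₁ (_ , j)) a∈L = inj₁ (combine (index a∈L) j)
  slot (inj₂ i)       _   = inj₂ i

  slot-injective : ∀ {L} v w (p : Within L v) (q : Within L w) → slot v p ≡ slot w q → v ≡ w
  slot-injective (inj₁ (a , i)) (inj₁ (b , j)) p q eq
    with combine-injective (index p) i (index q) j (inj₁-injective eq)
  ... | same , refl =
    cong (λ c → inj₁ (c , i)) (Membership.index-injective (setoid (Fin r)) p q same)
  slot-injective (inj₂ _) (inj₂ _) _ _ eq = cong inj₂ (inj₂-injective eq)

  within⇒≤ : ∀ {m} L {g : Fin m → BlowUp r s u} → Injective _≡_ _≡_ g →
    (∀ i → Within L (g i)) → m ≤ length L * s + u
  within⇒≤ L g-inj g∈L = injective⇒≤ λ {i} {j} eq →
    g-inj (slot-injective _ _ (g∈L i) (g∈L j) (Injection.injective (↔⇒↣ (↔-sym +↔⊎)) eq))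

  avoided⇒within : ∀ {d} a i w → tint (inj₁ (a , i)) w ≢ d → Within (avoiding d a a) w
  avoided⇒within {d} a i (inj₁ (c , j)) ac≢d = ∈-avoiding d a a ac≢d ac≢d
  avoided⇒within     a i (inj₂ _)       _    = tt

  block : ∀ v w → tint v w ≢ zero → ∃[ b ] w ≡ inj₁ b
  block (inj₁ _) (inj₁ b) _ = b , refl
  block (inj₁ _) (inj₂ _) p = contradiction refl p
  block (inj₂ _) _        p = contradiction refl p

-- Books that miss a colour

common-neighbours-bound : ∀ {r s u n} → Balanced r → (x y : BlowUp r s u) →
  {g : Fin n → BlowUp r s u} → Injective _≡_ _≡_ g → tint x y ≢ zero →
  (∀ i → tint x (g i) ≢ zero) → (∀ i → tint y (g i) ≢ zero) → n ≤ (r ∸ 2) * s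
common-neighbours-bound _ (inj₁ _) (inj₂ _) _ xy≢0 _ _ = contradiction refl xy≢0
common-neighbours-bound _ (inj₂ _) _        _ xy≢0 _ _ = contradiction refl xy≢0
common-neighbours-bound {r} {s} {u} {n} balanced x@(inj₁ (a , _)) y@(inj₁ (b , _)) {g} g-inj
  xy≢0 xg≢0 yg≢0 =
  begin
    n                                   ≤⟨ within⇒≤ {u = 0} (avoiding zero a b) page-injective page-within ⟩
    length (avoiding zero a b) * s + 0  ≡⟨ +-identityʳ _ ⟩
    length (avoiding zero a b) * s      ≤⟨ *-monoˡ-≤ s (Balanced.outside-pair balanced a b a≢b) ⟩
    (r ∸ 2) * s                         ∎
  where
  open ≤-Reasoning

  a≢b : a ≢ b
  a≢b refl = xy≢0 (hue-refl a)

  -- No page is an apex, so the pages are moved to the blow-up with `u = 0`; this removes the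
  -- summand `u` from the count.
  page : Fin n → BlowUp r s 0
  page i = inj₁ (proj₁ (block x (g i) (xg≢0 i)))

  g≡ : ∀ i → g i ≡ inj₁ (proj₁ (block x (g i) (xg≢0 i)))
  g≡ i = proj₂ (block x (g i) (xg≢0 i))

  page-injective : Injective _≡_ _≡_ page
  page-injective {i} {j} eq =
    g-inj (trans (g≡ i) (trans (cong inj₁ (inj₁-injective eq)) (sym (g≡ j))))

  page-within : ∀ i → Within (avoiding zero a b) (page i)
  page-within i = ∈-avoiding zero a b
    (subst (λ w → tint x w ≢ zero) (g≡ i) (xg≢0 i))
    (subst (λ w → tint y w ≢ zero) (g≡ i) (yg≢0 i))

-- Applied to the spine: an apex has no edge of a nonzero tint, so the count has to start from a
-- spine end inside a block.
some-block : ∀ {r s u} {g : Fin 2 → BlowUp r s u} → u ≤ 1 → Injective _≡_ _≡_ g →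
  ∃[ i ] ∃[ b ] g i ≡ inj₁ b
some-block {g = g} u≤1 g-inj with g zero in eq₀ | g (suc zero) in eq₁
... | inj₁ b | _      = zero , b , eq₀
... | inj₂ _ | inj₁ b = suc zero , b , eq₁
some-block (s≤s z≤n) g-inj | inj₂ zero | inj₂ zero =
  contradiction (g-inj (trans eq₀ (sym eq₁))) λ ()

module _ {r : ℕ} (s u : ℕ) {n : ℕ} (balanced : Balanced r) (u≤1 : u ≤ 1)
         (pages> : (r ∸ 2) * s < n) (book> : 3 * s + u < 2 + n) where

  uses-every-shade : {h : Vertex (Book n) → BlowUp r s u} → Injective _≡_ _≡_ h →
    ∀ d → ¬ (∀ {x y} → Adj (Book n) x y → tint (h x) (h y) ≢ d)
  uses-every-shade {h} h-inj zero missing = <⇒≱ pages>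
    (common-neighbours-bound balanced (h (inj₁ zero)) (h (inj₁ (suc zero))) (inj₂-injective ∘ h-inj)
      (missing {inj₁ zero} {inj₁ (suc zero)} (left λ ()))
      (λ i → missing {inj₁ zero} {inj₂ i} cross)
      (λ i → missing {inj₁ (suc zero)} {inj₂ i} cross))
  uses-every-shade {h} h-inj (suc d) missing
    with some-block u≤1 (inj₁-injective ∘ h-inj)
  ... | i , (a , j) , hi≡ = <⇒≱ book> (begin
    2 + n             ≤⟨ within⇒≤ L (Injection.injective (↔⇒↣ +↔⊎) ∘ h-inj)
                           (λ k → within (Inverse.to (+↔⊎ {2}) k)) ⟩
    length L * s + u  ≤⟨ +-monoˡ-≤ u (*-monoˡ-≤ s (Balanced.outside-shade balanced a d)) ⟩
    3 * s + u         ∎)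
    where
    open ≤-Reasoning

    L : List (Fin r)
    L = avoiding (suc d) a a

    avoided : ∀ w → tint (h (inj₁ i)) (h w) ≢ suc d
    avoided (inj₂ k) = missing {inj₁ i} {inj₂ k} cross
    avoided (inj₁ k) with i ≟ k
    -- The spine end is itself one of the `2 + n` vertices counted; its tint with itself is `zero`,
    -- hence not `suc d`.
    ... | yes refl = λ eq → contradiction (trans (sym (tint-refl (h (inj₁ i)))) eq) λ ()
    ... | no i≢k   = missing {inj₁ i} {inj₁ k} (left i≢k)

    within : ∀ w → Within L (h w)
    within w = avoided⇒within a j (h w) (subst (λ v → tint v (h w) ≢ suc d) hi≡ (avoided w))

  -- The colouring restricts to any `q` vertices of the blow-up, and `3 ≤ t` embeds its three tints
  -- in the palette.
  not-forced : ∀ {t q} → 3 ≤ t → q ≤ r * s + u → ¬ Forces t 2 (Book n) q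
  not-forced {t} {q} 3≤t q≤ forces = uses-every-shade (Copy.injective C ∘ ι-injective) d missing
    where
    ι : Fin q → BlowUp r s u
    ι x = map₁ (Inverse.to *↔×) (Inverse.to +↔⊎ (inject≤ x q≤))

    ι-injective : Injective _≡_ _≡_ ι
    ι-injective = inject≤-injective q≤ q≤ _ _ ∘ Injection.injective (↔⇒↣ +↔⊎) ∘ map₁-injective _ _
      where
      map₁-injective : ∀ (v w : Fin (r * s) ⊎ Fin u) →
        map₁ (Inverse.to *↔×) v ≡ map₁ (Inverse.to (*↔× {r} {s})) w → v ≡ w
      map₁-injective (inj₁ _) (inj₁ _) eq = cong inj₁ (Injection.injective (↔⇒↣ *↔×) (inj₁-injective eq))
      map₁-injective (inj₂ _) (inj₂ _) eq = cong inj₂ (inj₂-injective eq)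

    toColour : Fin 3 → Fin t
    toColour c = inject≤ c 3≤t

    f : Colouring t (K q)
    f = record
      { colour     = λ {x} {y} _ → toColour (tint (ι x) (ι y))
      ; colour-sym = λ {x} {y} _ _ → cong toColour (tint-sym (ι x) (ι y))
      }

    gallai : IsGallai f
    gallai (x , y , z , _ , _ , _ , p , q , q′) =
      tint-gallai (ι x) (ι y) (ι z) (p ∘ cong toColour) (q ∘ cong toColour) (q′ ∘ cong toColour)

    C : Copy (Book n) (K q)
    C = proj₁ (forces f gallai)

    S : Subset t
    S = proj₁ (proj₂ (forces f gallai))

    outside : ∃[ d ] ¬ toColour d ∈ₛ S
    outside = ∃-outside S (inject≤-injective 3≤t 3≤t _ _)
      (s≤s (proj₁ (proj₂ (proj₂ (forces f gallai)))))

    d : Fin 3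
    d = proj₁ outside

    missing : ∀ {x y} → Adj (Book n) x y → tint (ι (Copy.vertex C x)) (ι (Copy.vertex C y)) ≢ d
    missing e eq = proj₂ outside
      (subst (λ c → toColour c ∈ₛ S) eq (proj₂ (proj₂ (proj₂ (forces f gallai))) e))

  gallai-ramsey> : ∀ {t gr} → 3 ≤ t → IsGallaiRamsey t 2 (Book n) gr → r * s + u < gr
  gallai-ramsey> 3≤t isGR =
    ≰⇒> λ gr≤ → not-forced 3≤t gr≤ (IsGallaiRamsey.forces isGR)

-- The three residue classes

m≡k*3⇒m/3≡k : ∀ {m} k → m ≡ k * 3 → m / 3 ≡ k
m≡k*3⇒m/3≡k k eq = trans (cong (_/ 3) eq) (m*n/n≡m k 3)

theorem2p6 : ∀ (t n : ℕ) → t ≥ 3 → n ≥ 3 →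
    ∀ (gr : ℕ) → IsGallaiRamsey t 2 (Book n) gr →
    (n % 3 ≡ 0 → gr ≥ (4 * n + 6) / 3) ×
    (n % 3 ≡ 1 → gr ≥ (5 * n + 1) / 3) ×
    (n % 3 ≡ 2 → gr ≥ (4 * n + 7) / 3)
theorem2p6 t n t≥3 n≥3 gr isGR =
  -- In each class the numerator is a multiple of 3, so the truncating division is exact.
  (λ n%3≡0 → residue-0 (n / 3) (decompose n%3≡0) n≥3 isGR) ,
  (λ n%3≡1 → residue-1 (n / 3) (decompose n%3≡1) isGR) ,
  (λ n%3≡2 → residue-2 (n / 3) (decompose n%3≡2) n≥3 isGR)
  where
  decompose : ∀ {i} → n % 3 ≡ i → n ≡ i + n / 3 * 3
  decompose n%3≡i = trans (m≡m%n+[m/n]*n n 3) (cong (_+ n / 3 * 3) n%3≡i)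

  residue-0 : ∀ {n} k → n ≡ k * 3 → n ≥ 3 → IsGallaiRamsey t 2 (Book n) gr → gr ≥ (4 * n + 6) / 3
  residue-0 (suc k) refl _ isGR = subst (_≤ gr) (sym (m≡k*3⇒m/3≡k (suc (4 * suc k + 1)) (solve k)))
    -- With s = n / 3 the page condition 2s < 3s needs s > 0, and the book condition 3s + 1 < 3s + 2
    -- is tight.
    (gallai-ramsey> (suc k) 1 balanced-path ≤-refl
      (subst (2 * suc k <_) (pages k) (m≤m+n _ k)) (subst (3 * suc k + 1 <_) (book k) ≤-refl)
      t≥3 isGR)
    where
    solve : ∀ k → 4 * (suc k * 3) + 6 ≡ suc (4 * suc k + 1) * 3
    solve = solve-∀
    pages : ∀ k → suc (2 * suc k) + k ≡ suc k * 3
    pages = solve-∀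
    book : ∀ k → suc (3 * suc k + 1) ≡ 2 + suc k * 3
    book = solve-∀

  residue-1 : ∀ {n} k → n ≡ 1 + k * 3 → IsGallaiRamsey t 2 (Book n) gr → gr ≥ (5 * n + 1) / 3
  residue-1 k refl isGR = subst (_≤ gr) (sym (m≡k*3⇒m/3≡k (suc (5 * k + 1)) (solve k)))
    (gallai-ramsey> k 1 balanced-cycle ≤-refl
      (subst (3 * k <_) (pages k) ≤-refl) (subst (3 * k + 1 <_) (book k) (m≤m+n _ 1))
      t≥3 isGR)
    where
    solve : ∀ k → 5 * (1 + k * 3) + 1 ≡ suc (5 * k + 1) * 3
    solve = solve-∀
    pages : ∀ k → suc (3 * k) ≡ 1 + k * 3
    pages = solve-∀
    book : ∀ k → suc (3 * k + 1) + 1 ≡ 2 + (1 + k * 3)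
    book = solve-∀

  residue-2 : ∀ {n} k → n ≡ 2 + k * 3 → n ≥ 3 → IsGallaiRamsey t 2 (Book n) gr → gr ≥ (4 * n + 7) / 3
  -- This is n = 2, where s = 1 would turn the page condition into 2 < 2.
  residue-2 zero refl (s≤s (s≤s ()))
  residue-2 (suc k) refl _ isGR = subst (_≤ gr) (sym (m≡k*3⇒m/3≡k (suc (4 * (2 + k) + 0)) (solve k)))
    -- Here s = (n + 1) / 3, so 3s = n + 1 is already the largest value below n + 2 and leaves no
    -- room for an apex.
    (gallai-ramsey> (2 + k) 0 balanced-path z≤n
      (subst (2 * (2 + k) <_) (pages k) (m≤m+n _ k)) (subst (3 * (2 + k) + 0 <_) (book k) ≤-refl)
      t≥3 isGR)
    where
    solve : ∀ k → 4 * (2 + suc k * 3) + 7 ≡ suc (4 * (2 + k) + 0) * 3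
    solve = solve-∀
    pages : ∀ k → suc (2 * (2 + k)) + k ≡ 2 + suc k * 3
    pages = solve-∀
    book : ∀ k → suc (3 * (2 + k) + 0) ≡ 2 + (2 + suc k * 3)
    book = solve-∀
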